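{- Let $a,b\in\mathbb{Z}$ be such that the polynomial $f(x)=x^8+ax^6+bx^4+ax^2+1$ is monogenic, let $\alpha$ be a root of $f$, and let $K=\mathbb{Q}(\alpha)$. Put $m=a^2-4b+8$, and assume that $m<0$ and that $m$ is square-free. Let $\delta=\alpha^2+\alpha^{ -2}\in K$, let $\sqrt{m}$ denote the square root of $m$ in $K$ for which $\delta=\frac{ -a+\sqrt{m}}{2}$, that is, $\sqrt{m}=2\delta+a$, and let $\omega=\frac{1+\sqrt{m}}{2}$. Then $$\gamma=\left(\frac{a+1}{2}-\omega\right)\alpha+\alpha^3$$ generates a power integral basis in $K$.
   Context: For a number field $K$ of degree $n$ with ring of integers $\mathbb{Z}_K$, an element $\xi\in\mathbb{Z}_K$ generates a power integral basis in $K$ if $(1,\xi,\ldots,\xi^{n-1})$ is a $\mathbb{Z}$-basis of $\mathbb{Z}_K$, i.e. $\mathbb{Z}_K=\mathbb{Z}[\xi]$ (equivalently, the index $I(\xi)=(\mathbb{Z}_K:\mathbb{Z}[\xi])$ equals $1$). A monic polynomial $f(x)\in\mathbb{Z}[x]$ is called monogenic if it is irreducible over $\mathbb{Q}$ and a root $\xi$ of $f$ generates a power integral basis in $\mathbb{Q}(\xi)$. For $f(x)=x^8+ax^6+bx^4+ax^2+1$ and a root $\alpha$ of $f$, the element $\delta=\alpha^2+\alpha^{ -2}$ satisfies $\delta^2+a\delta+(b-2)=0$, so $(2\delta+a)^2=a^2-4b+8=m$, and $\alpha$ satisfies $\alpha^4-\delta\alpha^2+1=0$. The field $M=\mathbb{Q}(\delta)=\mathbb{Q}(\sqrt{m})$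 is a quadratic subfield of $K$. If $m$ is square-free then $a$ is odd and $m\equiv 1\pmod 4$, so $(1,\omega)$ is an integral basis of $M$. -}

module Defs where

open import Level using (0ℓ) renaming (suc to lsuc)
open import Algebra.Apartness.Bundles using (HeytingCommutativeRing; HeytingField)
open import Algebra.Bundles using (RawRing; RawSemiring; CommutativeRing)
import Algebra.Definitions.RawSemiring as RawSemiringDefinitions
open import Algebra.Morphism.Structures using (module RingMorphisms)
open import Data.Fin.Base using (toℕ)
open import Data.Integer.Base as ℤ using (ℤ; 0ℤ; 1ℤ)
open import Data.Integer.Divisibility using (_∣_)
open import Data.List.Base using (List; []; _∷_; map)
open import Data.Nat.Base using (ℕ; zero; suc; _<_)
open import Data.Product.Base using (∃-syntax; _×_)
open import Data.Rational.Base as ℚ using (ℚ; _/_)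
open import Data.Vec.Functional using (Vector)
open import Relation.Unary using (Pred; U)

SquareFree : ℤ → Set
SquareFree m = ∀ d → d ℤ.* d ∣ m → d ∣ 1ℤ

fromℤ : ℤ → ℚ
fromℤ z = z / 1

-- A polynomial is the list of its coefficients, constant term first.  Trailing
-- zeros are allowed, so equality of polynomials is _≈ₚ_ and not _≡_.
module Polynomial (R : RawRing 0ℓ 0ℓ) where
  open RawRing R

  Poly : Set
  Poly = List Carrier

  coeff : Poly → ℕ → Carrier
  coeff []      _       = 0#
  coeff (c ∷ p) zero    = c
  coeff (c ∷ p) (suc k) = coeff p k

  infix 4 _≈ₚ_
  _≈ₚ_ : Poly → Poly → Set
  p ≈ₚ q = ∀ k → coeff p k ≈ coeff q k

  infixl 6 _+ₚ_
  _+ₚ_ : Poly → Poly → Poly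
  []      +ₚ q       = q
  (c ∷ p) +ₚ []      = c ∷ p
  (c ∷ p) +ₚ (d ∷ q) = (c + d) ∷ (p +ₚ q)

  infixl 7 _*ₚ_
  _*ₚ_ : Poly → Poly → Poly
  []      *ₚ q = []
  (c ∷ p) *ₚ q = map (c *_) q +ₚ (0# ∷ (p *ₚ q))

  polyRawSemiring : RawSemiring 0ℓ 0ℓ
  polyRawSemiring = record
    { Carrier = Poly
    ; _≈_     = _≈ₚ_
    ; _+_     = _+ₚ_
    ; _*_     = _*ₚ_
    ; 0#      = []
    ; 1#      = 1# ∷ []
    }

  Monic : Poly → Set
  Monic p = ∃[ n ] (coeff p n ≈ 1# × (∀ k → n < k → coeff p k ≈ 0#))

  eval : Poly → Carrier → Carrier
  eval []      x = 0#
  eval (c ∷ p) x = c + x * eval p x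

module ℤ[x] = Polynomial ℤ.+-*-rawRing
module ℚ[x] = Polynomial ℚ.+-*-rawRing

IrreducibleOverℚ : ℤ[x].Poly → Set
IrreducibleOverℚ p =
  RawSemiringDefinitions.Irreducible ℚ[x].polyRawSemiring (map fromℤ p)

module LinearAlgebra (K : RawRing 0ℓ 0ℓ) where
  open RawRing K
  open RawSemiringDefinitions rawSemiring using (sum)

  -- v is a basis of S as a module over R, which acts on K by multiplication
  -- through φ.
  record IsBasis (R : RawRing 0ℓ 0ℓ) (φ : RawRing.Carrier R → Carrier)
                 {n : ℕ} (v : Vector Carrier n) (S : Pred Carrier 0ℓ) : Set where
    combination : Vector (RawRing.Carrier R) n → Carrier
    combination c = sum (λ i → φ (c i) * v i)

    field
      member      : ∀ i → S (v i)
      spanning    : ∀ x → S x → ∃[ c ] (x ≈ combination c)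
      independent : ∀ c → combination c ≈ 0# →
                    ∀ i → RawRing._≈_ R (c i) (RawRing.0# R)

record NumberField : Set (lsuc 0ℓ) where
  field
    heytingField : HeytingField 0ℓ 0ℓ 0ℓ

  open HeytingField heytingField public

  rawRing : RawRing 0ℓ 0ℓ
  rawRing = CommutativeRing.rawRing
    (HeytingCommutativeRing.commutativeRing heytingCommutativeRing)

  open RawSemiringDefinitions (RawRing.rawSemiring rawRing) public using (_^_)
  open LinearAlgebra rawRing public
  module K[x] = Polynomial rawRing

  field
    ι                     : ℚ → Carrier
    ι-isHomomorphism      : RingMorphisms.IsRingHomomorphism ℚ.+-*-rawRing rawRing ι
    degree                : ℕ
    rationalBasis         : Vector Carrier degree
    rationalBasis-isBasis : IsBasis ℚ.+-*-rawRing ι rationalBasis U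

  ιℤ : ℤ → Carrier
  ιℤ z = ι (fromℤ z)

  evalℤ : ℤ[x].Poly → Carrier → Carrier
  evalℤ p = K[x].eval (map ιℤ p)

  evalℚ : ℚ[x].Poly → Carrier → Carrier
  evalℚ p = K[x].eval (map ι p)

  IsRoot : ℤ[x].Poly → Carrier → Set
  IsRoot p x = evalℤ p x ≈ 0#

  -- The ring of integers, as a subset of the field.
  Integral : Pred Carrier 0ℓ
  Integral x = ∃[ p ] (ℤ[x].Monic p × IsRoot p x)

  -- The field is ℚ(ξ): every element is a quotient p(ξ)/q(ξ).
  IsGeneratedBy : Carrier → Set
  IsGeneratedBy ξ =
    ∀ x → ∃[ p ] ∃[ q ] (evalℚ q ξ # 0# × x * evalℚ q ξ ≈ evalℚ p ξ)

  powers : Carrier → Vector Carrier degree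
  powers ξ i = ξ ^ toℕ i

  GeneratesPowerIntegralBasis : Carrier → Set
  GeneratesPowerIntegralBasis ξ =
    Integral ξ × IsBasis ℤ.+-*-rawRing ιℤ (powers ξ) Integral

-- For p irreducible the pair (ℚ(ξ), ξ) does not depend, up to isomorphism, on
-- the root ξ, so the last condition is required of every root.
record Monogenic (p : ℤ[x].Poly) : Set (lsuc 0ℓ) where
  field
    monic       : ℤ[x].Monic p
    irreducible : IrreducibleOverℚ p
    generates   : (K : NumberField) → let open NumberField K in
                  (ξ : Carrier) → IsRoot p ξ → IsGeneratedBy ξ →
                  GeneratesPowerIntegralBasis ξ

f : ℤ → ℤ → ℤ[x].Poly
f a b = 1ℤ ∷ 0ℤ ∷ a ∷ 0ℤ ∷ b ∷ 0ℤ ∷ a ∷ 0ℤ ∷ 1ℤ ∷ []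

{-# OPTIONS --safe #-}
module Submission where

-- Since ω = (a + 1)/2 + δ, the element γ is α³ − δα = −α⁻¹.  The polynomial f is
-- even and reciprocal, so γ is again a root of f; and f(γ) = 0 expresses
-- α = −γ⁻¹ as a polynomial in γ, so γ generates K as well.  Monogenicity of f,
-- applied to the root γ instead of α, is the conclusion.

open import Defs
open import Algebra.Bundles using (CommutativeRing)
open import Algebra.Apartness.Bundles using (HeytingCommutativeRing)
open import Algebra.Morphism.Structures using (module RingMorphisms)
import Algebra.Properties.Group as GroupProperties
import Algebra.Properties.AbelianGroup as AbelianGroupProperties
import Algebra.Properties.Ring as RingProperties
import Algebra.Solver.Ring.NaturalCoefficients.Default as NaturalCoefficients
open import Data.Empty using (⊥-elim)
open import Data.Integer.Base as ℤ using (ℤ; +_; 0ℤ; 1ℤ)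
import Data.Integer.Solver as ℤSolver
open import Data.List.Base using ([]; _∷_; map)
open import Data.Product.Base using (_,_)
open import Data.Rational.Base as ℚ using (_/_; ½; 1ℚ; toℚᵘ)
import Data.Rational.Properties as ℚ
open import Data.Rational.Unnormalised.Base as ℚᵘ using (mkℚᵘ; *≡*)
import Data.Rational.Unnormalised.Properties as ℚᵘ
open import Data.Sum.Base using (inj₁; inj₂)
open import Relation.Binary.PropositionalEquality as ≡ using (_≡_)
import Relation.Binary.Reasoning.Setoid as SetoidReasoning

-- For variable `n` the fraction on the left does not compute, since `_/_` divides by a gcd. Among
-- unnormalised rationals equality is cross multiplication, which leaves an identity of integers.
[n+1]/2≡½*[n+1] : ∀ n → (n ℤ.+ 1ℤ) / 2 ≡ ½ ℚ.* (fromℤ n ℚ.+ 1ℚ)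
[n+1]/2≡½*[n+1] n = ℚ.toℚᵘ-injective (begin
  toℚᵘ ((n ℤ.+ 1ℤ) / 2)                     ≈⟨ ℚ.toℚᵘ-fromℚᵘ (mkℚᵘ (n ℤ.+ 1ℤ) 1) ⟩
  -- `mkℚᵘ` stores the denominator minus one, so the arguments 1 and 0 stand for the denominators 2
  -- and 1.
  mkℚᵘ (n ℤ.+ 1ℤ) 1                         ≈⟨ *≡* (crossMultiplied n) ⟩
  ℚᵘ.½ ℚᵘ.* (mkℚᵘ n 0 ℚᵘ.+ ℚᵘ.1ℚᵘ)          ≈⟨ ℚᵘ.*-congˡ {ℚᵘ.½} (ℚᵘ.+-congˡ ℚᵘ.1ℚᵘ (ℚ.toℚᵘ-fromℚᵘ (mkℚᵘ n 0))) ⟨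
  ℚᵘ.½ ℚᵘ.* (toℚᵘ (fromℤ n) ℚᵘ.+ ℚᵘ.1ℚᵘ)    ≈⟨ ℚᵘ.*-congˡ {ℚᵘ.½} (ℚ.toℚᵘ-homo-+ (fromℤ n) 1ℚ) ⟨
  ℚᵘ.½ ℚᵘ.* toℚᵘ (fromℤ n ℚ.+ 1ℚ)           ≈⟨ ℚ.toℚᵘ-homo-* ½ (fromℤ n ℚ.+ 1ℚ) ⟨
  toℚᵘ (½ ℚ.* (fromℤ n ℚ.+ 1ℚ))             ∎)
  where
  open SetoidReasoning ℚᵘ.≃-setoid
  open ℤSolver.+-*-Solver
  crossMultiplied : ∀ n → (n ℤ.+ 1ℤ) ℤ.* + 2 ≡ (1ℤ ℤ.* (n ℤ.* + 1 ℤ.+ 1ℤ ℤ.* + 1)) ℤ.* + 2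
  crossMultiplied = solve 1 (λ n →
    (n :+ con 1ℤ) :* con (+ 2) :=
    (con 1ℤ :* (n :* con (+ 1) :+ con 1ℤ :* con (+ 1))) :* con (+ 2)) ≡.refl

-- Composition of rational polynomials.

module ℚ[x]-Composition where
  open ℚ[x]

  infixr 9 _∘ₚ_
  -- Horner's scheme, mirroring `eval`, so that the evaluation law follows by induction on the outer
  -- polynomial.
  _∘ₚ_ : Poly → Poly → Poly
  []      ∘ₚ r = []
  (c ∷ p) ∘ₚ r = (c ∷ []) +ₚ r *ₚ (p ∘ₚ r)

open ℚ[x]-Composition

module NumberFieldProperties (K : NumberField) where
  open NumberField K
  open RingMorphisms.IsRingHomomorphism ι-isHomomorphism
    using (+-homo; *-homo; 0#-homo; 1#-homo)

  private
    commutativeRing : CommutativeRing _ _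
    commutativeRing = HeytingCommutativeRing.commutativeRing heytingCommutativeRing

  open CommutativeRing commutativeRing using (ring; +-group; +-abelianGroup; commutativeSemiring)
  open GroupProperties +-group using (x∙y⁻¹≈ε⇒x≈y)
  open AbelianGroupProperties +-abelianGroup using (⁻¹-anti-homo‿-; xyx⁻¹≈y)
  open RingProperties ring using (-‿distribˡ-*; -‿distribʳ-*)
  open NaturalCoefficients commutativeSemiring
    using (solve; _:+_; _:*_; _:=_; con) renaming (Polynomial to Expr)
  open SetoidReasoning setoid

  ιℤ-0 : ιℤ 0ℤ ≈ 0#
  ιℤ-0 = 0#-homo

  ιℤ-1 : ιℤ 1ℤ ≈ 1#
  ιℤ-1 = 1#-homo

  ι-½*2 : ι ½ * ιℤ (+ 2) ≈ 1#
  ι-½*2 = trans (sym (*-homo ½ (fromℤ (+ 2)))) 1#-homo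

  ι-[n+1]/2 : ∀ n → ι ((n ℤ.+ 1ℤ) / 2) ≈ ι ½ * (ιℤ n + 1#)
  ι-[n+1]/2 n = begin
    ι ((n ℤ.+ 1ℤ) / 2)         ≡⟨ ≡.cong ι ([n+1]/2≡½*[n+1] n) ⟩
    ι (½ ℚ.* (fromℤ n ℚ.+ 1ℚ)) ≈⟨ *-homo ½ (fromℤ n ℚ.+ 1ℚ) ⟩
    ι ½ * ι (fromℤ n ℚ.+ 1ℚ)   ≈⟨ *-congˡ (trans (+-homo (fromℤ n) 1ℚ) (+-congˡ 1#-homo)) ⟩
    ι ½ * (ιℤ n + 1#)          ∎

  -- Cotransitivity places `y` apart from `x` or from `z`, and the first contradicts `x ≈ y`. This
  -- keeps denominators nonzero when they are rewritten.
  #-respˡ-≈ : ∀ {x y z} → x ≈ y → x # z → y # z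
  #-respˡ-≈ {y = y} x≈y x#z with #-cotrans x#z y
  ... | inj₁ x#y = ⊥-elim (#-irrefl x≈y x#y)
  ... | inj₂ y#z = y#z

  -- Evaluation of rational polynomials in the field.

  evalℚ-cong : ∀ p {x y} → x ≈ y → evalℚ p x ≈ evalℚ p y
  evalℚ-cong []      x≈y = refl
  evalℚ-cong (c ∷ p) x≈y = +-congˡ (*-cong x≈y (evalℚ-cong p x≈y))

  evalℚ-+ₚ : ∀ p q x → evalℚ (p ℚ[x].+ₚ q) x ≈ evalℚ p x + evalℚ q x
  evalℚ-+ₚ []      q       x = sym (+-identityˡ _)
  evalℚ-+ₚ (c ∷ p) []      x = sym (+-identityʳ _)
  evalℚ-+ₚ (c ∷ p) (d ∷ q) x = begin
    ι (c ℚ.+ d) + x * evalℚ (p ℚ[x].+ₚ q) x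
      ≈⟨ +-cong (+-homo c d) (*-congˡ (evalℚ-+ₚ p q x)) ⟩
    (ι c + ι d) + x * (evalℚ p x + evalℚ q x)
      ≈⟨ solve 5 (λ c d x p q → (c :+ d) :+ x :* (p :+ q) := (c :+ x :* p) :+ (d :+ x :* q))
           refl (ι c) (ι d) x (evalℚ p x) (evalℚ q x) ⟩
    (ι c + x * evalℚ p x) + (ι d + x * evalℚ q x) ∎

  evalℚ-scale : ∀ c p x → evalℚ (map (c ℚ.*_) p) x ≈ ι c * evalℚ p x
  evalℚ-scale c []      x = sym (zeroʳ _)
  evalℚ-scale c (d ∷ p) x = begin
    ι (c ℚ.* d) + x * evalℚ (map (c ℚ.*_) p) x
      ≈⟨ +-cong (*-homo c d) (*-congˡ (evalℚ-scale c p x)) ⟩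
    ι c * ι d + x * (ι c * evalℚ p x)
      ≈⟨ solve 4 (λ c d x p → c :* d :+ x :* (c :* p) := c :* (d :+ x :* p))
           refl (ι c) (ι d) x (evalℚ p x) ⟩
    ι c * (ι d + x * evalℚ p x) ∎

  evalℚ-*ₚ : ∀ p q x → evalℚ (p ℚ[x].*ₚ q) x ≈ evalℚ p x * evalℚ q x
  evalℚ-*ₚ []      q x = sym (zeroˡ _)
  evalℚ-*ₚ (c ∷ p) q x = begin
    evalℚ (map (c ℚ.*_) q ℚ[x].+ₚ (ℚ.0ℚ ∷ p ℚ[x].*ₚ q)) x
      ≈⟨ evalℚ-+ₚ (map (c ℚ.*_) q) (ℚ.0ℚ ∷ p ℚ[x].*ₚ q) x ⟩
    evalℚ (map (c ℚ.*_) q) x + (ι ℚ.0ℚ + x * evalℚ (p ℚ[x].*ₚ q) x)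
      ≈⟨ +-cong (evalℚ-scale c q x) (+-cong 0#-homo (*-congˡ (evalℚ-*ₚ p q x))) ⟩
    ι c * evalℚ q x + (0# + x * (evalℚ p x * evalℚ q x))
      ≈⟨ solve 4 (λ c x p q → c :* q :+ (con 0 :+ x :* (p :* q)) := (c :+ x :* p) :* q)
           refl (ι c) x (evalℚ p x) (evalℚ q x) ⟩
    (ι c + x * evalℚ p x) * evalℚ q x ∎

  evalℚ-∘ₚ : ∀ p r x → evalℚ (p ∘ₚ r) x ≈ evalℚ p (evalℚ r x)
  evalℚ-∘ₚ []      r x = refl
  evalℚ-∘ₚ (c ∷ p) r x = begin
    evalℚ ((c ∷ []) ℚ[x].+ₚ r ℚ[x].*ₚ (p ∘ₚ r)) x
      ≈⟨ evalℚ-+ₚ (c ∷ []) (r ℚ[x].*ₚ (p ∘ₚ r)) x ⟩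
    (ι c + x * 0#) + evalℚ (r ℚ[x].*ₚ (p ∘ₚ r)) x
      ≈⟨ +-cong (trans (+-congˡ (zeroʳ x)) (+-identityʳ (ι c)))
           (trans (evalℚ-*ₚ r (p ∘ₚ r) x) (*-congˡ (evalℚ-∘ₚ p r x))) ⟩
    ι c + evalℚ r x * evalℚ p (evalℚ r x) ∎

  -- Substituting `r` into numerator and denominator turns a fraction in `x` into a fraction in `y`
  -- of the same value.
  isGeneratedBy-polynomial : ∀ {x y} r → x ≈ evalℚ r y → IsGeneratedBy x → IsGeneratedBy y
  isGeneratedBy-polynomial {x} {y} r x≈r[y] gen z with gen z
  ... | p , q , q[x]#0 , zq≈p =
    p ∘ₚ r , q ∘ₚ r , #-respˡ-≈ (substituted q) q[x]#0 ,
    trans (*-congˡ (sym (substituted q))) (trans zq≈p (substituted p))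
    where
    substituted : ∀ s → evalℚ s x ≈ evalℚ (s ∘ₚ r) y
    substituted s = trans (evalℚ-cong s x≈r[y]) (sym (evalℚ-∘ₚ s r y))

  -- The octic f and its symmetries.

  module _ (a b : ℤ) where

    private
      A B : Carrier
      A = ιℤ a
      B = ιℤ b

    -- (f(x) − 1)/x.
    f-tail : ℚ[x].Poly
    f-tail = map fromℤ (0ℤ ∷ a ∷ 0ℤ ∷ b ∷ 0ℤ ∷ a ∷ 0ℤ ∷ 1ℤ ∷ [])

    -- The quartic g with f(x) = g(x²), in Horner form.
    halved : Carrier → Carrier
    halved s = 1# + s * (A + s * (B + s * (A + s * 1#)))

    evalℤ-f : ∀ x → evalℤ (f a b) x ≈ halved (x * x)
    evalℤ-f x = begin
      evalℤ (f a b) x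
        -- The images of 1 and 0 under `ιℤ` enter as variables `o` and `z`. The odd-degree terms
        -- collect into a multiple of `z`, which then vanishes.
        ≈⟨ solve 5 (λ o z A B x →
             o :+ x :* (z :+ x :* (A :+ x :* (z :+ x :* (B :+ x :* (z :+ x :* (A :+ x :* (z :+ x :* (o :+ x :* con 0)))))))) :=
             (o :+ (x :* x) :* (A :+ (x :* x) :* (B :+ (x :* x) :* (A :+ (x :* x) :* o))))
               :+ z :* (x :+ x :* x :* x :+ x :* x :* x :* x :* x :+ x :* x :* x :* x :* x :* x :* x))
             refl (ιℤ 1ℤ) (ιℤ 0ℤ) A B x ⟩
      (ιℤ 1ℤ + (x * x) * (A + (x * x) * (B + (x * x) * (A + (x * x) * ιℤ 1ℤ)))) + ιℤ 0ℤ * _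
        ≈⟨ +-cong
             (+-cong ιℤ-1 (*-congˡ (+-congˡ (*-congˡ (+-congˡ (*-congˡ (+-congˡ (*-congˡ ιℤ-1))))))))
             (trans (*-congʳ ιℤ-0) (zeroˡ _)) ⟩
      halved (x * x) + 0# ≈⟨ +-identityʳ _ ⟩
      halved (x * x)      ∎

    -- The quartic g is palindromic: writing t⁴ g(s) in terms of u = st and t, and then setting u =
    -- 1, gives g(t).
    halved-reciprocal : ∀ {s t} → s * t ≈ 1# → halved s ≈ 0# → halved t ≈ 0#
    halved-reciprocal {s} {t} st≈1 h[s]≈0 = begin
      halved t
        ≈⟨ solve 3 (λ A B t →
             con 1 :+ t :* (A :+ t :* (B :+ t :* (A :+ t :* con 1))) :=
             homogeneous A B (con 1) t) refl A B t ⟩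
      -- The hypothesis st = 1 is not a ring identity, so it enters by congruence in `u`, between
      -- two calls of the solver.
      t⁴h 1#       ≈⟨ t⁴h-cong st≈1 ⟨
      t⁴h (s * t)
        ≈⟨ solve 4 (λ A B s t →
             homogeneous A B (s :* t) t :=
             t :* t :* t :* t :* (con 1 :+ s :* (A :+ s :* (B :+ s :* (A :+ s :* con 1)))))
             refl A B s t ⟩
      t * t * t * t * halved s ≈⟨ trans (*-congˡ h[s]≈0) (zeroʳ _) ⟩
      0#                       ∎
      where
      -- t⁴ h(s) as a polynomial in u = s t and t.
      t⁴h : Carrier → Carrier
      t⁴h u = t * t * t * t + u * (A * (t * t * t) + u * (B * (t * t) + u * (A * t + u)))
      homogeneous : ∀ {n} → Expr n → Expr n → Expr n → Expr n → Expr n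
      homogeneous A B u t =
        t :* t :* t :* t :+ u :* (A :* (t :* t :* t) :+ u :* (B :* (t :* t) :+ u :* (A :* t :+ u)))
      t⁴h-cong : ∀ {u v} → u ≈ v → t⁴h u ≈ t⁴h v
      t⁴h-cong e = +-congˡ (*-cong e (+-congˡ (*-cong e (+-congˡ (*-cong e (+-congˡ e))))))

    -- The negated inverse of a root.

    module _ {α β γ : Carrier} (αβ≈1 : α * β ≈ 1#) (γ≈-β : γ ≈ - β) where

      γ²≈β² : γ * γ ≈ β * β
      γ²≈β² = begin
        γ * γ       ≈⟨ *-cong γ≈-β γ≈-β ⟩
        - β * - β   ≈⟨ -‿distribˡ-* β (- β) ⟨
        - (β * - β) ≈⟨ -‿cong (sym (-‿distribʳ-* β β)) ⟩
        - - (β * β) ≈⟨ GroupProperties.⁻¹-involutive +-group (β * β) ⟩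
        β * β       ∎

      -- Since f(x) depends only on x², the sign of γ is immaterial, and γ² = β² is inverse to α².
      isRoot-negatedInverse : IsRoot (f a b) α → IsRoot (f a b) γ
      isRoot-negatedInverse f[α]≈0 = trans (evalℤ-f γ)
        (halved-reciprocal α²γ²≈1 (trans (sym (evalℤ-f α)) f[α]≈0))
        where
        α²γ²≈1 : (α * α) * (γ * γ) ≈ 1#
        α²γ²≈1 = begin
          (α * α) * (γ * γ) ≈⟨ *-congˡ γ²≈β² ⟩
          (α * α) * (β * β)
            ≈⟨ solve 2 (λ α β → (α :* α) :* (β :* β) := (α :* β) :* (α :* β)) refl α β ⟩
          (α * β) * (α * β) ≈⟨ *-cong αβ≈1 αβ≈1 ⟩
          1# * 1#           ≈⟨ *-identityˡ 1# ⟩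
          1#                ∎

      -- With `r` the value of `f-tail` at γ, f(γ) = 1 + γr = 1 - βr. Its vanishing gives βr = 1,
      -- and multiplying by α gives α = r.
      α≈f-tail[γ] : IsRoot (f a b) γ → α ≈ evalℚ f-tail γ
      α≈f-tail[γ] f[γ]≈0 = begin
        α           ≈⟨ *-identityʳ α ⟨
        α * 1#      ≈⟨ *-congˡ (x∙y⁻¹≈ε⇒x≈y 1# (β * r) 1-βr≈0) ⟩
        α * (β * r) ≈⟨ *-assoc α β r ⟨
        α * β * r   ≈⟨ *-congʳ αβ≈1 ⟩
        1# * r      ≈⟨ *-identityˡ r ⟩
        r           ∎
        where
        r : Carrier
        r = evalℚ f-tail γ
        1-βr≈0 : 1# - β * r ≈ 0#
        1-βr≈0 = begin
          1# - β * r      ≈⟨ +-cong (sym ιℤ-1) (trans (-‿distribˡ-* β r) (*-congʳ (sym γ≈-β))) ⟩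
          -- On the explicit coefficient list, `evalℤ (f a b) γ` unfolds to this sum by computation.
          ιℤ 1ℤ + γ * r   ≈⟨ f[γ]≈0 ⟩
          0#              ∎

    -- The rational parts of `ω` and of (a + 1)/2 cancel, leaving α³ - δα. Here δα = α³ + α⁻¹,
    -- because α⁻²α = α⁻¹, so the cubes cancel too.
    γ≈-α⁻¹ : ∀ {α α⁻¹} → α * α⁻¹ ≈ 1# →
      let δ = α ^ 2 + α⁻¹ ^ 2 in
      (ι ((a ℤ.+ 1ℤ) / 2) - ι ½ * (1# + (ιℤ (+ 2) * δ + ιℤ a))) * α + α ^ 3 ≈ - α⁻¹
    γ≈-α⁻¹ {α} {β} αβ≈1 = begin
      (P - ω) * α + α ^ 3             ≈⟨ +-congʳ (*-congʳ P-ω≈-δ) ⟩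
      - δ * α + α ^ 3                 ≈⟨ +-congʳ (-‿distribˡ-* δ α) ⟨
      - (δ * α) + α ^ 3               ≈⟨ +-comm _ _ ⟩
      α ^ 3 - δ * α                   ≈⟨ ⁻¹-anti-homo‿- (δ * α) (α ^ 3) ⟨
      - (δ * α - α ^ 3)               ≈⟨ -‿cong (+-congʳ δα≈α³+β) ⟩
      - (α ^ 3 + β - α ^ 3)           ≈⟨ -‿cong (xyx⁻¹≈y (α ^ 3) β) ⟩
      - β                             ∎
      where
      P δ ω : Carrier
      P = ι ((a ℤ.+ 1ℤ) / 2)
      δ = α ^ 2 + β ^ 2
      ω = ι ½ * (1# + (ιℤ (+ 2) * δ + ιℤ a))

      ω≈P+δ : ω ≈ P + δ
      ω≈P+δ = begin
        ι ½ * (1# + (ιℤ (+ 2) * δ + A))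
          -- The images of ½ and 2 stay as variables `h` and `t`; that their product is 1 is used
          -- only in the next step.
          ≈⟨ solve 4 (λ h t δ A →
               h :* (con 1 :+ (t :* δ :+ A)) := h :* (A :+ con 1) :+ (h :* t) :* δ)
               refl (ι ½) (ιℤ (+ 2)) δ A ⟩
        ι ½ * (A + 1#) + (ι ½ * ιℤ (+ 2)) * δ
          ≈⟨ +-cong (sym (ι-[n+1]/2 a)) (trans (*-congʳ ι-½*2) (*-identityˡ δ)) ⟩
        P + δ ∎

      P-ω≈-δ : P - ω ≈ - δ
      P-ω≈-δ = begin
        P - ω     ≈⟨ ⁻¹-anti-homo‿- ω P ⟨
        - (ω - P) ≈⟨ -‿cong (trans (+-congʳ ω≈P+δ) (xyx⁻¹≈y P δ)) ⟩
        - δ       ∎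

      δα≈α³+β : δ * α ≈ α ^ 3 + β
      δα≈α³+β = begin
        δ * α
          -- Powers are written out as `_^_` unfolds, with a final factor 1.
          ≈⟨ solve 2 (λ α β →
               (α :* (α :* con 1) :+ β :* (β :* con 1)) :* α :=
               α :* (α :* (α :* con 1)) :+ (α :* β) :* β) refl α β ⟩
        α ^ 3 + (α * β) * β ≈⟨ +-congˡ (trans (*-congʳ αβ≈1) (*-identityˡ β)) ⟩
        α ^ 3 + β           ∎

theorem6 : (a b : ℤ) → Monogenic (f a b) →
    let m = a ℤ.* a ℤ.- + 4 ℤ.* b ℤ.+ + 8 in
    m ℤ.< 0ℤ → SquareFree m →
    (K : NumberField) → let open NumberField K in
    (α α⁻¹ : Carrier) → IsRoot (f a b) α → IsGeneratedBy α → α * α⁻¹ ≈ 1# →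
    let δ  = α ^ 2 + α⁻¹ ^ 2
        √m = ιℤ (+ 2) * δ + ιℤ a
        ω  = ι ½ * (1# + √m)
        γ  = (ι ((a ℤ.+ 1ℤ) / 2) - ω) * α + α ^ 3
    in GeneratesPowerIntegralBasis γ
theorem6 a b mono _ _ K α α⁻¹ f[α]≈0 gen αα⁻¹≈1 =
  Monogenic.generates mono K _ f[γ]≈0
    (isGeneratedBy-polynomial (f-tail a b) (α≈f-tail[γ] a b αα⁻¹≈1 γ≈ f[γ]≈0) gen)
  where
  open NumberFieldProperties K
  γ≈ = γ≈-α⁻¹ a b αα⁻¹≈1
  f[γ]≈0 = isRoot-negatedInverse a b αα⁻¹≈1 γ≈ f[α]≈0
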